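{- Let $\mathbb{F}_q$ be a finite field with $q$ elements and let $P(X,Z)\in\mathbb{F}_q[X,Z]$ be monic in $Z$ with $\deg_Z P\ge 2$. Suppose that $$Q(X,Y,Z)=XQ_1(X,Y,Z)+Y^m-b(Z),$$ where $Q_1(X,Y,Z)\in\mathbb{F}_q[X,Y,Z]$, $b(Z)\in\mathbb{F}_q[Z]$, $\deg_Y Q_1<m$ and $m\ge 2$. Set $d_m=\gcd(m,q-1)$ and $$N_0'=\#\{(\beta,\gamma)\in\mathbb{F}_q^2\mid P(0,\gamma)=0,\ Q(0,\beta,\gamma)=0\}.$$ (i) Define $$n_0=\#\{\gamma\in\mathbb{F}_q\mid P(0,\gamma)=0,\ b(\gamma)=0\},$$ $$n_1=\#\{\gamma\in\mathbb{F}_q\mid P(0,\gamma)=0,\ b(\gamma)\ne 0,\ b(\gamma)^{(q-1)/d_m}=1\}.$$ Then $N_0'=n_0+d_m n_1$. (ii) In particular, if $b(Z)=aZ^m$ with $a\in\mathbb{F}_q$, and if $P(0,Z)$ has $r$ distinct roots in $\mathbb{F}_q$, then $$N_0'=\begin{cases} r, & a=0,\\ \delta, & a\ne 0\text{ and }a^{(q-1)/d_m}\ne 1,\\ d_m r+(1-d_m)\delta, & a\neq 0\text{ and }a^{(q-1)/d_m}=1,\end{cases}$$ where $\delta=1$ if $P(0,0)=0$ and $\delta=0$ if $P(0,0)\ne 0$.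
   Context: "Monic in $Z$" means leading coefficient $1$ as a polynomial in $Z$ over the polynomial ring in the other variables. -}

module Defs where

open import Algebra.Apartness using (HeytingField)
open import Algebra.Apartness.Bundles using (module HeytingCommutativeRing)
open import Algebra.Bundles using (CommutativeRing)
open import Algebra.Bundles.Raw using (RawRing)
import Algebra.Definitions.RawSemiring as RawSemiringDefs
open import Data.Bool.Base using (if_then_else_)
open import Data.Fin.Base using (Fin)
open import Data.Fin.Properties using (inj⇒≟)
open import Data.List.Base
  using (List; []; _∷_; map; length; filter; tabulate; cartesianProduct)
open import Data.Nat.Base as ℕ
  using (ℕ; zero; suc; _∸_; _<_; _≤_; NonZero; NonTrivial; nonTrivial⇒nonZero)
open import Data.Nat.DivMod using (_/_)
open import Data.Nat.GCD using (gcd; gcd[m,n]≢0)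
open import Data.Product.Base using (_×_; _,_; ∃)
open import Data.Sum.Base using (inj₁)
open import Function.Bundles using (Inverse)
import Function.Construct.Symmetry as Symmetry
open import Function.Properties.Inverse using (Inverse⇒Injection)
open import Level using (Level; _⊔_) renaming (suc to lsuc)
open import Relation.Binary.Definitions using (Decidable)
import Relation.Binary.PropositionalEquality as ≡
open import Relation.Nullary.Decidable using (_×-dec_; ¬?; does)
open import Relation.Unary as U using (Pred)

-- Over a finite carrier invertibility is decidable, so the apartness of a
-- Heyting field is just ¬ (x ≈ y) and this is the usual notion of field.  The
-- zero ring is excluded: its differences are invertible, hence apart, which
-- contradicts irreflexivity.
record FiniteField (c ℓ₁ ℓ₂ : Level) : Set (lsuc (c ⊔ ℓ₁ ⊔ ℓ₂)) where
  field
    heytingField : HeytingField c ℓ₁ ℓ₂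

  open HeytingField heytingField using (heytingCommutativeRing)

  commutativeRing : CommutativeRing c ℓ₁
  commutativeRing = HeytingCommutativeRing.commutativeRing heytingCommutativeRing

  open CommutativeRing commutativeRing public

  field
    order       : ℕ
    enumeration : Inverse (≡.setoid (Fin order)) setoid

  elements : List Carrier
  elements = tabulate (Inverse.to enumeration)

  infix 4 _≟_
  _≟_ : Decidable _≈_
  _≟_ = inj⇒≟ (Inverse⇒Injection (Symmetry.inverse enumeration))

-- One-variable polynomials over R are coefficient lists, constant term first.
-- Trailing zeros are allowed; equality is equality of all coefficients.
module Polynomial {c ℓ} (R : RawRing c ℓ) where
  open RawRing R

  Poly : Set c
  Poly = List Carrier

  coeff : Poly → ℕ → Carrier
  coeff []      _       = 0#
  coeff (a ∷ _) zero    = a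
  coeff (_ ∷ p) (suc n) = coeff p n

  infix  4 _≈ₚ_
  infixl 6 _+ₚ_
  infixl 7 _*ₚ_

  _≈ₚ_ : Poly → Poly → Set ℓ
  p ≈ₚ q = ∀ n → coeff p n ≈ coeff q n

  _+ₚ_ : Poly → Poly → Poly
  []      +ₚ q       = q
  (a ∷ p) +ₚ []      = a ∷ p
  (a ∷ p) +ₚ (b ∷ q) = (a + b) ∷ (p +ₚ q)

  _*ₚ_ : Poly → Poly → Poly
  []      *ₚ q = []
  (a ∷ p) *ₚ q = map (a *_) q +ₚ (0# ∷ (p *ₚ q))

  const : Carrier → Poly
  const a = a ∷ []

  indeterminate : Poly
  indeterminate = 0# ∷ 1# ∷ []

  polyRing : RawRing c ℓ
  polyRing = record
    { Carrier = Poly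
    ; _≈_     = _≈ₚ_
    ; _+_     = _+ₚ_
    ; _*_     = _*ₚ_
    ; -_      = map (-_)
    ; 0#      = []
    ; 1#      = const 1#
    }

  eval : Carrier → Poly → Carrier
  eval x []      = 0#
  eval x (a ∷ p) = a + x * eval x p

  HasDegree : Poly → ℕ → Set ℓ
  HasDegree p d = coeff p d ≉ 0# × (∀ k → d < k → coeff p k ≈ 0#)

  -- The zero polynomial has degree below every bound.
  DegreeBelow : Poly → ℕ → Set ℓ
  DegreeBelow p m = ∀ k → m ≤ k → coeff p k ≈ 0#

  Monic : Poly → Set ℓ
  Monic p = ∃ λ d → HasDegree p d × coeff p d ≈ 1#

-- Cardinality of the subset of xs cut out by P, for xs without repetitions.
count : ∀ {a p} {A : Set a} {P : Pred A p} → U.Decidable P → List A → ℕ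
count P? xs = length (filter P? xs)

module Setting {c ℓ₁ ℓ₂} (𝔽 : FiniteField c ℓ₁ ℓ₂) where
  open FiniteField 𝔽 public
    using (Carrier; _≈_; _≉_; 0#; 1#; rawRing; elements; _≟_)
    renaming (order to q)
  open RawSemiringDefs (RawRing.rawSemiring rawRing) public using (_^_)

  -- The same module serves F[X] and F[Z].  Two and three variables are
  -- iterated: F[X,Z] is F[X][Z] and F[X,Y,Z] is F[X][Z][Y], so the degree in
  -- the last variable is the outermost one.
  module F[T]     = Polynomial rawRing
  module F[X,Z]   = Polynomial F[T].polyRing
  module F[X,Y,Z] = Polynomial F[X,Z].polyRing

  open RawRing F[T].polyRing public using ()
    renaming (_≈_ to _≈₁_; _*_ to _*₁_)
  open RawSemiringDefs (RawRing.rawSemiring F[T].polyRing) public using ()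
    renaming (_^_ to _^₁_)
  open RawRing F[X,Y,Z].polyRing public using ()
    renaming (_≈_ to _≈₃_; _+_ to _+₃_; _*_ to _*₃_; -_ to -₃_)
  open RawSemiringDefs (RawRing.rawSemiring F[X,Y,Z].polyRing) public using ()
    renaming (_^_ to _^₃_)

  X Y : F[X,Y,Z].Poly
  X = F[X,Y,Z].const (F[X,Z].const F[T].indeterminate)
  Y = F[X,Y,Z].indeterminate

  inZ : F[T].Poly → F[X,Y,Z].Poly
  inZ b = F[X,Y,Z].const (map F[T].const b)

  eval₁ : Carrier → F[T].Poly → Carrier
  eval₁ = F[T].eval

  -- Substituting x for X in every coefficient turns F[X][Z] into F[Z].
  atX : Carrier → F[X,Z].Poly → F[T].Poly
  atX x = map (eval₁ x)

  eval₂ : (x z : Carrier) → F[X,Z].Poly → Carrier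
  eval₂ x z p = eval₁ z (atX x p)

  eval₃ : (x y z : Carrier) → F[X,Y,Z].Poly → Carrier
  eval₃ x y z p = eval₁ y (map (eval₂ x z) p)

  d : ℕ → ℕ
  d m = gcd m (q ∸ 1)

  d-nonZero : ∀ m .{{_ : NonTrivial m}} → NonZero (d m)
  d-nonZero (suc m) = ℕ.≢-nonZero (gcd[m,n]≢0 (suc m) (q ∸ 1) (inj₁ λ ()))

  [q-1]/d : ∀ m .{{_ : NonTrivial m}} → ℕ
  [q-1]/d m = _/_ (q ∸ 1) (d m) {{d-nonZero m}}

  N₀′ : F[X,Z].Poly → F[X,Y,Z].Poly → ℕ
  N₀′ P Q = count
    (λ (β , γ) → (eval₂ 0# γ P ≟ 0#) ×-dec (eval₃ 0# β γ Q ≟ 0#))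
    (cartesianProduct elements elements)

  n₀ : F[X,Z].Poly → F[T].Poly → ℕ
  n₀ P b = count
    (λ γ → (eval₂ 0# γ P ≟ 0#) ×-dec (eval₁ γ b ≟ 0#))
    elements

  n₁ : F[X,Z].Poly → F[T].Poly → ∀ m .{{_ : NonTrivial m}} → ℕ
  n₁ P b m = count
    (λ γ → (eval₂ 0# γ P ≟ 0#) ×-dec ¬? (eval₁ γ b ≟ 0#)
           ×-dec (eval₁ γ b ^ [q-1]/d m ≟ 1#))
    elements

  #roots : F[T].Poly → ℕ
  #roots f = count (λ γ → eval₁ γ f ≟ 0#) elements

  δ : F[X,Z].Poly → ℕ
  δ P = if does (eval₂ 0# 0# P ≟ 0#) then 1 else 0

{-# OPTIONS --safe #-}
-- Modulo X, the equation Q = 0 reads Y ^ m = b(Z), so N₀′ is the sum over the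
-- roots γ of P(0,Z) of the number of m-th roots of b(γ).  Put n = q − 1 and
-- d = gcd(m,n).  By Bézout and Fermat, the m-th roots of c ≠ 0 all have the same
-- d-th power, so there are at most d of them.  The n nonzero elements are spread
-- by x ↦ x ^ m over the solutions of c ^ (n / d) = 1, of which there are at most
-- n / d.  Hence n ≤ d · (n / d) = n, all these bounds are equalities, and every
-- such c has exactly d m-th roots.
module Submission where

open import Defs

open import Algebra.Apartness using (HeytingField)
open import Algebra.Bundles using (CommutativeRing)
open import Algebra.Bundles.Raw using (RawRing)
import Algebra.Definitions.RawSemiring as RawSemiringDefs
open import Algebra.Morphism.Structures using (IsRingHomomorphism)
import Algebra.Morphism.Construct.Identity as Identity
import Algebra.Properties.CommutativeMonoid.Sum as MonoidSum
import Algebra.Properties.CommutativeSemigroup as CommutativeSemigroup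
import Algebra.Properties.CommutativeSemiring.Exp as Exp
import Algebra.Properties.Ring as RingProperties
import Algebra.Properties.Semiring.Sum as SemiringSum
import Algebra.Solver.Ring.NaturalCoefficients.Default as SemiringSolver
open import Data.Bool.Base using (if_then_else_; true; false)
open import Data.Fin.Base using (Fin; zero; suc; punchIn)
import Data.Fin.Permutation as Permutation
open import Data.Fin.Properties using (any?; punchInᵢ≢i)
import Data.Integer.Properties as ℤ
import Data.Integer.Solver as ℤSolver
open import Data.List.Base using (List; []; _∷_; map; length; tabulate; filter; _++_; cartesianProduct)
open import Data.List.Properties using (filter-++; length-++)
open import Data.List.Relation.Unary.All as All using (All; []; _∷_)
open import Data.List.Relation.Unary.All.Properties using (all-filter)
import Data.List.Relation.Unary.Unique.Setoid as UniqueSetoid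
import Data.List.Relation.Unary.Unique.Setoid.Properties as Uniqueₚ
open import Data.List.Relation.Unary.AllPairs using ([]; _∷_)
open import Data.Nat.Base as ℕ using (NonZero; zero; suc; z≤n; s≤s; _∸_)
open import Data.Nat.Divisibility using (_∣_; divides-refl; *-monoʳ-∣)
open import Data.Nat.DivMod using (m/n*n≡m)
open import Data.Nat.GCD using (gcd; gcd-GCD; gcd[m,n]∣m; gcd[m,n]∣n; module Bézout)
import Data.Nat.Properties as ℕ
open import Data.Product.Base using (_,_; proj₁; proj₂)
open import Data.Vec.Base as Vec using (Vec; []; _∷_)
open import Data.Vec.Functional using (Vector; removeAt)
open import Function.Base using (_∘_; id)
open import Function.Bundles using (module Inverse)
open import Level using (Level)
import Relation.Binary.PropositionalEquality as ≡
import Relation.Binary.Reasoning.Setoid as SetoidReasoning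
open import Relation.Nullary.Decidable using (Dec; yes; no; does; _×-dec_; ¬?; decidable-stable)
open import Relation.Nullary.Negation using (¬_; contradiction)
import Relation.Unary as U

open import Data.Nat.Base using (ℕ; _+_; _*_; _≤_; NonTrivial)
open import Data.Product.Base using (_×_; ∃)
open import Relation.Binary.PropositionalEquality.Core using (_≡_)

open SemiringSum ℕ.+-*-semiring
  using (sum; sum-syntax; sum-cong-≗; sum-remove; sum-replicate-zero; ∑-comm; ∑-distrib-+; *-distribˡ-sum; *-distribʳ-sum)

-- No generator of the multiplicative group is used: double counting replaces cyclicity, and the
-- structural inputs are Fermat's theorem and the bound on the number of roots of a monic
-- polynomial. Cardinalities are handled as sums of 0/1 indicators over `Fin q`. The carrier is a
-- setoid, where elements are identified only up to `≈`, while indices are compared strictly; on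
-- indices, double counting is an interchange of sums, and `sum-tight` turns the comparison of two
-- totals into equality of every term.

private module ℕ* = CommutativeSemigroup ℕ.*-commutativeSemigroup

private variable
  a p : Level
  A B C : Set a
  n : ℕ

-- Finite sums of natural numbers

sum-ones : ∀ n → ∑[ i < n ] 1 ≡ n
sum-ones zero    = ≡.refl
sum-ones (suc n) = ≡.cong suc (sum-ones n)

sum-zero : (f : Vector ℕ n) → (∀ i → f i ≡ 0) → sum f ≡ 0
sum-zero {n} f f≡0 = ≡.trans (sum-cong-≗ f≡0) (sum-replicate-zero n)

sum-single : (f : Vector ℕ n) (j : Fin n) → (∀ i → i ≡.≢ j → f i ≡ 0) → sum f ≡ f j
sum-single {suc n} f j f≡0 = begin
  sum f                      ≡⟨ sum-remove {i = j} f ⟩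
  f j + sum (removeAt f j)   ≡⟨ ≡.cong (f j +_) (sum-zero _ λ i → f≡0 (punchIn j i) (punchInᵢ≢i j i)) ⟩
  f j + 0                    ≡⟨ ℕ.+-identityʳ (f j) ⟩
  f j                        ∎
  where open ≡.≡-Reasoning

sum-mono : (f g : Vector ℕ n) → (∀ i → f i ≤ g i) → sum f ≤ sum g
sum-mono {zero}  f g f≤g = z≤n
sum-mono {suc n} f g f≤g = ℕ.+-mono-≤ (f≤g zero) (sum-mono (f ∘ suc) (g ∘ suc) (f≤g ∘ suc))

-- A strict inequality at one index could not be made up elsewhere. At the head, the tails already
-- satisfy `F ≤ G`, so cancelling them leaves `g zero ≤ f zero`; cancelling the heads instead gives
-- the hypothesis for the tails.
sum-tight : (f g : Vector ℕ n) → (∀ i → f i ≤ g i) → sum g ≤ sum f → ∀ i → f i ≡ g i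
sum-tight {suc n} f g f≤g ∑g≤∑f = λ where
    zero    → ℕ.≤-antisym (f≤g zero) (ℕ.+-cancelʳ-≤ G (g zero) (f zero)
                (ℕ.≤-trans ∑g≤∑f (ℕ.+-monoʳ-≤ (f zero) F≤G)))
    (suc i) → sum-tight (f ∘ suc) (g ∘ suc) (f≤g ∘ suc)
                (ℕ.+-cancelˡ-≤ (g zero) G F (ℕ.≤-trans ∑g≤∑f (ℕ.+-monoˡ-≤ F (f≤g zero)))) i
  where
  F = sum (f ∘ suc)
  G = sum (g ∘ suc)
  F≤G : F ≤ G
  F≤G = sum-mono (f ∘ suc) (g ∘ suc) (f≤g ∘ suc)

-- Indicators of decisions, and counting as summation

ind : Dec A → ℕ
ind a? = if does a? then 1 else 0

ind-yes : (a? : Dec A) → A → ind a? ≡ 1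
ind-yes (yes _) _ = ≡.refl
ind-yes (no ¬a) a = contradiction a ¬a

ind-no : (a? : Dec A) → ¬ A → ind a? ≡ 0
ind-no (yes a) ¬a = contradiction a ¬a
ind-no (no _)  _  = ≡.refl

ind-cong : (A → B) → (B → A) → (a? : Dec A) (b? : Dec B) → ind a? ≡ ind b?
ind-cong f g (yes a) b? = ≡.sym (ind-yes b? (f a))
ind-cong f g (no ¬a) b? = ≡.sym (ind-no b? (¬a ∘ g))

ind-× : (a? : Dec A) (b? : Dec B) → ind (a? ×-dec b?) ≡ ind a? * ind b?
ind-× (yes _) b? = ≡.sym (ℕ.+-identityʳ (ind b?))
ind-× (no _)  b? = ≡.refl

ind-complement : (a? : Dec A) → ind a? + ind (¬? a?) ≡ 1
ind-complement (yes _) = ≡.refl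
ind-complement (no _)  = ≡.refl

-- Later `A` says that γ is a root of P(0,Z), `B` that b(γ) vanishes, and `C` that b(γ) passes the
-- power test: each root is then counted once, in `n₁` or in `n₀`.
ind-split : (a? : Dec A) (b? : Dec B) (c? : Dec C) → (¬ B → C) →
            ind (a? ×-dec ¬? b? ×-dec c?) + ind (a? ×-dec b?) ≡ ind a?
ind-split (no _)  b?       c? _    = ≡.refl
ind-split (yes _) (yes _)  c? _    = ≡.refl
ind-split (yes _) (no ¬b)  c? ¬b→c = ≡.cong (_+ 0) (ind-yes c? (¬b→c ¬b))

count-∷ : {P : U.Pred A p} (P? : U.Decidable P) → ∀ x xs → count P? (x ∷ xs) ≡ ind (P? x) + count P? xs
count-∷ P? x xs with does (P? x)
... | true  = ≡.refl
... | false = ≡.refl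

count-tabulate : {P : U.Pred A p} (P? : U.Decidable P) (f : Fin n → A) →
                 count P? (tabulate f) ≡ ∑[ i < n ] ind (P? (f i))
count-tabulate {n = zero}  P? f = ≡.refl
count-tabulate {n = suc n} P? f =
  ≡.trans (count-∷ P? (f zero) _) (≡.cong (ind (P? (f zero)) +_) (count-tabulate P? (f ∘ suc)))

count-map : {P : U.Pred B p} (P? : U.Decidable P) (f : A → B) → ∀ xs →
            count P? (map f xs) ≡ count (P? ∘ f) xs
count-map P? f []       = ≡.refl
count-map P? f (x ∷ xs) = begin
  count P? (f x ∷ map f xs)             ≡⟨ count-∷ P? (f x) (map f xs) ⟩
  ind (P? (f x)) + count P? (map f xs)  ≡⟨ ≡.cong (ind (P? (f x)) +_) (count-map P? f xs) ⟩
  ind (P? (f x)) + count (P? ∘ f) xs    ≡⟨ count-∷ (P? ∘ f) x xs ⟨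
  count (P? ∘ f) (x ∷ xs)               ∎
  where open ≡.≡-Reasoning

count-++ : {P : U.Pred A p} (P? : U.Decidable P) → ∀ xs ys →
           count P? (xs ++ ys) ≡ count P? xs + count P? ys
count-++ P? xs ys = ≡.trans (≡.cong length (filter-++ P? xs ys)) (length-++ (filter P? xs))

count-cartesianProduct : {P : U.Pred (A × B) p} (P? : U.Decidable P) (f : Fin n → A) → ∀ ys →
  count P? (cartesianProduct (tabulate f) ys) ≡ ∑[ i < n ] count (λ y → P? (f i , y)) ys
count-cartesianProduct {n = zero}  P? f ys = ≡.refl
count-cartesianProduct {n = suc n} P? f ys = ≡.trans
  (count-++ P? (map (f zero ,_) ys) _)
  (≡.cong₂ _+_ (count-map P? (f zero ,_) ys) (count-cartesianProduct P? (f ∘ suc) ys))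

-- Evaluation of polynomials as a ring homomorphism. Only the target has to satisfy the ring laws.
-- The source is a raw ring, so the result can be iterated over the polynomial rings, each
-- evaluation serving as the coefficient map `φ` of the next.
module Evaluation {c ℓ c′ ℓ′} {R : RawRing c ℓ} (S : CommutativeRing c′ ℓ′)
  {φ : RawRing.Carrier R → CommutativeRing.Carrier S}
  (φ-homo : IsRingHomomorphism R (CommutativeRing.rawRing S) φ)
  where
  private
    module R = RawRing R
    module φ = IsRingHomomorphism φ-homo
  open CommutativeRing S
    renaming (_+_ to infixl 6 _⊕_; _*_ to infixl 7 _⊛_; -_ to infix 8 ⊖_)
  open Exp commutativeSemiring using (_^_)
  open RawSemiringDefs R.rawSemiring using () renaming (_^_ to _^ᴿ_)
  open Polynomial R
  open RingProperties ring using (-0#≈0#; -‿distribʳ-*; -‿+-comm)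
  open SemiringSolver commutativeSemiring using (solve; _:=_; _:+_; _:*_)
  open SetoidReasoning setoid

  ^-homo : ∀ x n → φ (x ^ᴿ n) ≈ φ x ^ n
  ^-homo x zero    = φ.1#-homo
  ^-homo x (suc n) = trans (φ.*-homo x _) (*-congˡ (^-homo x n))

  -- ⟦_⟧ is Horner evaluation at y with coefficients mapped by φ.  It is a
  -- parameter so that φ = id is covered without mapping the identity.
  module At (y : Carrier) (⟦_⟧ : Poly → Carrier)
            (⟦[]⟧ : ⟦ [] ⟧ ≈ 0#) (⟦∷⟧ : ∀ a p → ⟦ a ∷ p ⟧ ≈ φ a ⊕ y ⊛ ⟦ p ⟧) where

    ⟦const⟧ : ∀ a → ⟦ const a ⟧ ≈ φ a
    ⟦const⟧ a = begin
      ⟦ a ∷ [] ⟧         ≈⟨ ⟦∷⟧ a [] ⟩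
      φ a ⊕ y ⊛ ⟦ [] ⟧   ≈⟨ +-congˡ (trans (*-congˡ ⟦[]⟧) (zeroʳ y)) ⟩
      φ a ⊕ 0#           ≈⟨ +-identityʳ (φ a) ⟩
      φ a                ∎

    ⟦indeterminate⟧ : ⟦ indeterminate ⟧ ≈ y
    ⟦indeterminate⟧ = begin
      ⟦ indeterminate ⟧             ≈⟨ ⟦∷⟧ R.0# _ ⟩
      φ R.0# ⊕ y ⊛ ⟦ const R.1# ⟧   ≈⟨ +-cong φ.0#-homo (*-congˡ (trans (⟦const⟧ R.1#) φ.1#-homo)) ⟩
      0# ⊕ y ⊛ 1#                   ≈⟨ trans (+-identityˡ _) (*-identityʳ y) ⟩
      y                             ∎

    -- Trailing zeros are allowed, so a polynomial equal to `[]` may be a nonempty list; this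
    -- settles the comparison of lists of different lengths in `⟦⟧-cong′`.
    ⟦⟧-vanish : ∀ p → (∀ n → φ (coeff p n) ≈ 0#) → ⟦ p ⟧ ≈ 0#
    ⟦⟧-vanish []      _   = ⟦[]⟧
    ⟦⟧-vanish (a ∷ p) p≈0 = begin
      ⟦ a ∷ p ⟧         ≈⟨ ⟦∷⟧ a p ⟩
      φ a ⊕ y ⊛ ⟦ p ⟧   ≈⟨ +-cong (p≈0 0) (*-congˡ (⟦⟧-vanish p (p≈0 ∘ suc))) ⟩
      0# ⊕ y ⊛ 0#       ≈⟨ trans (+-identityˡ _) (zeroʳ y) ⟩
      0#                ∎

    ⟦⟧-cong′ : ∀ p q → (∀ n → φ (coeff p n) ≈ φ (coeff q n)) → ⟦ p ⟧ ≈ ⟦ q ⟧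
    ⟦⟧-cong′ []        q       p≈q = trans ⟦[]⟧ (sym (⟦⟧-vanish q λ n → trans (sym (p≈q n)) φ.0#-homo))
    ⟦⟧-cong′ p@(_ ∷ _) []      p≈q = trans (⟦⟧-vanish p λ n → trans (p≈q n) φ.0#-homo) (sym ⟦[]⟧)
    ⟦⟧-cong′ (a ∷ p)   (b ∷ q) p≈q = begin
      ⟦ a ∷ p ⟧         ≈⟨ ⟦∷⟧ a p ⟩
      φ a ⊕ y ⊛ ⟦ p ⟧   ≈⟨ +-cong (p≈q 0) (*-congˡ (⟦⟧-cong′ p q (p≈q ∘ suc))) ⟩
      φ b ⊕ y ⊛ ⟦ q ⟧   ≈⟨ ⟦∷⟧ b q ⟨
      ⟦ b ∷ q ⟧         ∎

    ⟦+⟧ : ∀ p q → ⟦ p +ₚ q ⟧ ≈ ⟦ p ⟧ ⊕ ⟦ q ⟧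
    ⟦+⟧ []      q       = sym (trans (+-congʳ ⟦[]⟧) (+-identityˡ _))
    ⟦+⟧ (a ∷ p) []      = sym (trans (+-congˡ ⟦[]⟧) (+-identityʳ _))
    ⟦+⟧ (a ∷ p) (b ∷ q) = begin
      ⟦ (a R.+ b) ∷ (p +ₚ q) ⟧                  ≈⟨ ⟦∷⟧ _ _ ⟩
      φ (a R.+ b) ⊕ y ⊛ ⟦ p +ₚ q ⟧              ≈⟨ +-cong (φ.+-homo a b) (*-congˡ (⟦+⟧ p q)) ⟩
      (φ a ⊕ φ b) ⊕ y ⊛ (⟦ p ⟧ ⊕ ⟦ q ⟧)         ≈⟨ solve 5 (λ s t y p q →
        (s :+ t) :+ y :* (p :+ q) := (s :+ y :* p) :+ (t :+ y :* q)) refl (φ a) (φ b) y ⟦ p ⟧ ⟦ q ⟧ ⟩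
      (φ a ⊕ y ⊛ ⟦ p ⟧) ⊕ (φ b ⊕ y ⊛ ⟦ q ⟧)     ≈⟨ +-cong (⟦∷⟧ a p) (⟦∷⟧ b q) ⟨
      ⟦ a ∷ p ⟧ ⊕ ⟦ b ∷ q ⟧                     ∎

    ⟦scale⟧ : ∀ a q → ⟦ map (a R.*_) q ⟧ ≈ φ a ⊛ ⟦ q ⟧
    ⟦scale⟧ a []      = trans ⟦[]⟧ (sym (trans (*-congˡ ⟦[]⟧) (zeroʳ (φ a))))
    ⟦scale⟧ a (b ∷ q) = begin
      ⟦ (a R.* b) ∷ map (a R.*_) q ⟧               ≈⟨ ⟦∷⟧ _ _ ⟩
      φ (a R.* b) ⊕ y ⊛ ⟦ map (a R.*_) q ⟧         ≈⟨ +-cong (φ.*-homo a b) (*-congˡ (⟦scale⟧ a q)) ⟩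
      φ a ⊛ φ b ⊕ y ⊛ (φ a ⊛ ⟦ q ⟧)                ≈⟨ solve 4 (λ s t y q →
        s :* t :+ y :* (s :* q) := s :* (t :+ y :* q)) refl (φ a) (φ b) y ⟦ q ⟧ ⟩
      φ a ⊛ (φ b ⊕ y ⊛ ⟦ q ⟧)                      ≈⟨ *-congˡ (⟦∷⟧ b q) ⟨
      φ a ⊛ ⟦ b ∷ q ⟧                              ∎

    ⟦*⟧ : ∀ p q → ⟦ p *ₚ q ⟧ ≈ ⟦ p ⟧ ⊛ ⟦ q ⟧
    ⟦*⟧ []      q = trans ⟦[]⟧ (sym (trans (*-congʳ ⟦[]⟧) (zeroˡ _)))
    ⟦*⟧ (a ∷ p) q = begin
      ⟦ map (a R.*_) q +ₚ (R.0# ∷ (p *ₚ q)) ⟧            ≈⟨ ⟦+⟧ (map (a R.*_) q) _ ⟩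
      ⟦ map (a R.*_) q ⟧ ⊕ ⟦ R.0# ∷ (p *ₚ q) ⟧           ≈⟨ +-cong (⟦scale⟧ a q) (⟦∷⟧ _ _) ⟩
      φ a ⊛ ⟦ q ⟧ ⊕ (φ R.0# ⊕ y ⊛ ⟦ p *ₚ q ⟧)            ≈⟨ +-congˡ (trans (+-congʳ φ.0#-homo) (+-identityˡ _)) ⟩
      φ a ⊛ ⟦ q ⟧ ⊕ y ⊛ ⟦ p *ₚ q ⟧                       ≈⟨ +-congˡ (*-congˡ (⟦*⟧ p q)) ⟩
      φ a ⊛ ⟦ q ⟧ ⊕ y ⊛ (⟦ p ⟧ ⊛ ⟦ q ⟧)                  ≈⟨ solve 4 (λ s y p q →
        s :* q :+ y :* (p :* q) := (s :+ y :* p) :* q) refl (φ a) y ⟦ p ⟧ ⟦ q ⟧ ⟩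
      (φ a ⊕ y ⊛ ⟦ p ⟧) ⊛ ⟦ q ⟧                          ≈⟨ *-congʳ (⟦∷⟧ a p) ⟨
      ⟦ a ∷ p ⟧ ⊛ ⟦ q ⟧                                  ∎

    ⟦-⟧ : ∀ p → ⟦ map R.-_ p ⟧ ≈ ⊖ ⟦ p ⟧
    ⟦-⟧ []      = trans ⟦[]⟧ (sym (trans (-‿cong ⟦[]⟧) -0#≈0#))
    ⟦-⟧ (a ∷ p) = begin
      ⟦ (R.- a) ∷ map R.-_ p ⟧          ≈⟨ ⟦∷⟧ _ _ ⟩
      φ (R.- a) ⊕ y ⊛ ⟦ map R.-_ p ⟧    ≈⟨ +-cong (φ.-‿homo a) (*-congˡ (⟦-⟧ p)) ⟩
      ⊖ φ a ⊕ y ⊛ ⊖ ⟦ p ⟧               ≈⟨ +-congˡ (-‿distribʳ-* y ⟦ p ⟧) ⟨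
      ⊖ φ a ⊕ ⊖ (y ⊛ ⟦ p ⟧)             ≈⟨ -‿+-comm _ _ ⟩
      ⊖ (φ a ⊕ y ⊛ ⟦ p ⟧)               ≈⟨ -‿cong (⟦∷⟧ a p) ⟨
      ⊖ ⟦ a ∷ p ⟧                       ∎

    ⟦⟧-homo : IsRingHomomorphism polyRing rawRing ⟦_⟧
    ⟦⟧-homo = record
      { isSemiringHomomorphism = record
        { isNearSemiringHomomorphism = record
          { +-isMonoidHomomorphism = record
            { isMagmaHomomorphism = record
              { isRelHomomorphism = record { cong = λ {p} {q} p≈q → ⟦⟧-cong′ p q (φ.⟦⟧-cong ∘ p≈q) }
              ; homo = ⟦+⟧
              }
            ; ε-homo = ⟦[]⟧
            }
          ; *-homo = ⟦*⟧
          }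
        ; 1#-homo = trans (⟦const⟧ R.1#) φ.1#-homo
        }
      ; -‿homo = ⟦-⟧
      }

≢⇒NonZero-pred : {i j : Fin n} → i ≡.≢ j → NonZero (n ∸ 1)
≢⇒NonZero-pred {suc zero}    {zero} {zero} i≢j = contradiction ≡.refl i≢j
≢⇒NonZero-pred {suc (suc n)} i≢j = _

-- Arithmetic in a finite field

module Field {c ℓ₁ ℓ₂} (𝔽 : FiniteField c ℓ₁ ℓ₂) where
  open FiniteField 𝔽 hiding (zero)
    renaming (_+_ to infixl 6 _⊕_; _*_ to infixl 7 _⊛_; _-_ to infixl 6 _⊖_; -_ to infix 8 ⊖_; order to q)
  open Exp commutativeSemiring
    using (_^_; ^-congˡ; ^-homo-*; ^-assocʳ; ^-distrib-*)
  open RingProperties ring using (-0#≈0#; +-cancelˡ; x∙y⁻¹≈ε⇒x≈y)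
  open SemiringSolver commutativeSemiring using (solve; _:=_; _:+_; _:*_)
  open UniqueSetoid setoid using (Unique)
  -- The sums of a commutative monoid, read multiplicatively: `∏.sum` is a product, and
  -- `∏.∑-distrib-+` splits a product factor by factor.
  module ∏ = MonoidSum *-commutativeMonoid
  module HF = HeytingField heytingField
  open Inverse enumeration using (to; from; from-cong; strictlyInverseˡ; strictlyInverseʳ)
  module ≈-Reasoning = SetoidReasoning setoid

  elements-unique : Unique elements
  elements-unique = Uniqueₚ.tabulate⁺ setoid λ {i} {j} to-i≈to-j →
    ≡.trans (≡.sym (strictlyInverseʳ i)) (≡.trans (from-cong to-i≈to-j) (strictlyInverseʳ j))

  to≉ : ∀ {x i} → i ≡.≢ from x → to i ≉ x
  to≉ i≢ to-i≈x = i≢ (≡.trans (≡.sym (strictlyInverseʳ _)) (from-cong to-i≈x))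

  1≉0 : 1# ≉ 0#
  1≉0 1≈0 = HF.#-irrefl 1≈0 (HF.invertible⇒# (1# , lemma , lemma′))
    where
    lemma′ : (1# ⊖ 0#) ⊛ 1# ≈ 1#
    lemma′ = trans (*-identityʳ _) (trans (+-congˡ -0#≈0#) (+-identityʳ 1#))
    lemma : 1# ⊛ (1# ⊖ 0#) ≈ 1#
    lemma = trans (*-comm _ _) lemma′

  -- Tightness only gives that x is not non-invertible; a search through the
  -- finite carrier extracts the inverse.
  inverse : ∀ {x} → x ≉ 0# → ∃ λ y → y ⊛ x ≈ 1#
  inverse {x} x≉0 with any? (λ i → to i ⊛ x ≟ 1#)
  ... | yes (i , eq) = to i , eq
  ... | no ∄ = contradiction (proj₁ (HF.tight x 0#) x¬#0) x≉0
    where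
    open ≈-Reasoning
    x¬#0 : ¬ (x HF.# 0#)
    x¬#0 x#0 with y , eq , _ ← HF.#⇒invertible x#0 = ∄ (from y , (begin
      to (from y) ⊛ x  ≈⟨ *-congʳ (strictlyInverseˡ y) ⟩
      y ⊛ x            ≈⟨ *-congˡ (trans (+-congˡ -0#≈0#) (+-identityʳ x)) ⟨
      y ⊛ (x ⊖ 0#)     ≈⟨ eq ⟩
      1#               ∎))

  *-cancelˡ : ∀ {x y z} → x ≉ 0# → x ⊛ y ≈ x ⊛ z → y ≈ z
  *-cancelˡ {x} {y} {z} x≉0 xy≈xz with x⁻¹ , eq ← inverse x≉0 = begin
    y              ≈⟨ undo y ⟨
    x⁻¹ ⊛ (x ⊛ y)  ≈⟨ *-congˡ xy≈xz ⟩
    x⁻¹ ⊛ (x ⊛ z)  ≈⟨ undo z ⟩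
    z              ∎
    where
    open ≈-Reasoning
    undo : ∀ w → x⁻¹ ⊛ (x ⊛ w) ≈ w
    undo w = trans (sym (*-assoc _ _ _)) (trans (*-congʳ eq) (*-identityˡ w))

  *-≉0 : ∀ {x y} → x ≉ 0# → y ≉ 0# → x ⊛ y ≉ 0#
  *-≉0 x≉0 y≉0 xy≈0 = y≉0 (*-cancelˡ x≉0 (trans xy≈0 (sym (zeroʳ _))))

  ^-≉0 : ∀ {x} n → x ≉ 0# → x ^ n ≉ 0#
  ^-≉0 zero    x≉0 = 1≉0
  ^-≉0 (suc n) x≉0 = *-≉0 x≉0 (^-≉0 n x≉0)

  ≈0⇒^≈0 : ∀ {x} n .{{_ : NonZero n}} → x ≈ 0# → x ^ n ≈ 0#
  ≈0⇒^≈0 (suc n) x≈0 = trans (*-congʳ x≈0) (zeroˡ _)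

  ^≉0⇒≉0 : ∀ {x} n .{{_ : NonZero n}} → x ^ n ≉ 0# → x ≉ 0#
  ^≉0⇒≉0 n x^n≉0 x≈0 = x^n≉0 (≈0⇒^≈0 n x≈0)

  1^n≈1 : ∀ n → 1# ^ n ≈ 1#
  1^n≈1 zero    = refl
  1^n≈1 (suc n) = trans (*-identityˡ _) (1^n≈1 n)

  nonzero? : ∀ x → Dec (x ≉ 0#)
  nonzero? x = ¬? (x ≟ 0#)

  count-zero : ∑[ i < q ] ind (to i ≟ 0#) ≡ 1
  count-zero = ≡.trans
    (sum-single _ (from 0#) λ i i≢ → ind-no (to i ≟ 0#) (to≉ i≢))
    (ind-yes (to (from 0#) ≟ 0#) (strictlyInverseˡ 0#))

  count-nonzero : ∑[ i < q ] ind (nonzero? (to i)) ≡ q ∸ 1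
  count-nonzero = ≡.cong (_∸ 1) (begin
    suc N                              ≡⟨ ≡.cong (_+ N) count-zero ⟨
    ∑[ i < q ] ind (to i ≟ 0#) + N     ≡⟨ ∑-distrib-+ (λ i → ind (to i ≟ 0#)) _ ⟨
    ∑[ i < q ] (ind (to i ≟ 0#) + ind (nonzero? (to i)))
                                       ≡⟨ sum-cong-≗ (λ i → ind-complement (to i ≟ 0#)) ⟩
    ∑[ i < q ] 1                       ≡⟨ sum-ones q ⟩
    q                                  ∎)
    where
    open ≡.≡-Reasoning
    N = ∑[ i < q ] ind (nonzero? (to i))

  q-1-nonZero : NonZero (q ∸ 1)
  q-1-nonZero = ≢⇒NonZero-pred {i = from 1#} {from 0#} λ eq → 1≉0 (begin
    1#            ≈⟨ strictlyInverseˡ 1# ⟨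
    to (from 1#)  ≡⟨ ≡.cong to eq ⟩
    to (from 0#)  ≈⟨ strictlyInverseˡ 0# ⟩
    0#            ∎)
    where open ≈-Reasoning

  ∏-≉0 : (f : Vector Carrier n) → (∀ i → f i ≉ 0#) → ∏.sum f ≉ 0#
  ∏-≉0 {zero}  f f≉0 = 1≉0
  ∏-≉0 {suc n} f f≉0 = *-≉0 (f≉0 zero) (∏-≉0 (f ∘ suc) (f≉0 ∘ suc))

  ∏-^ : ∀ x (e : Vector ℕ n) → ∏.sum (λ i → x ^ e i) ≈ x ^ sum e
  ∏-^ {zero}  x e = refl
  ∏-^ {suc n} x e = trans (*-congˡ (∏-^ x (e ∘ suc))) (sym (^-homo-* x (e zero) _))

  -- Multiplication by x permutes the nonzero elements; the exponent ε y discards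
  -- the zero element from the product.
  fermat : ∀ {x} → x ≉ 0# → x ^ (q ∸ 1) ≈ 1#
  fermat {x} x≉0 with x⁻¹ , x⁻¹x≈1 ← inverse x≉0 = *-cancelˡ Π≉0 (begin
    Π ⊛ x ^ (q ∸ 1)                                          ≈⟨ *-comm _ _ ⟩
    x ^ (q ∸ 1) ⊛ Π                                          ≡⟨ ≡.cong (λ e → x ^ e ⊛ Π) count-nonzero ⟨
    x ^ ∑[ i < q ] ε (to i) ⊛ Π                              ≈⟨ *-congʳ (∏-^ x (ε ∘ to)) ⟨
    ∏.sum (λ i → x ^ ε (to i)) ⊛ Π                           ≈⟨ ∏.∑-distrib-+ (λ i → x ^ ε (to i)) _ ⟨
    ∏.sum (λ i → x ^ ε (to i) ⊛ to i ^ ε (to i))             ≈⟨ ∏.sum-cong-≋ step ⟨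
    ∏.sum (λ i → to (π i) ^ ε (to (π i)))                    ≈⟨ ∏.sum-permute (λ i → to i ^ ε (to i)) perm ⟨
    Π                                                        ≈⟨ *-identityʳ Π ⟨
    Π ⊛ 1#                                                   ∎)
    where
    open ≈-Reasoning
    ε : Carrier → ℕ
    ε y = ind (nonzero? y)

    Π : Carrier
    Π = ∏.sum (λ i → to i ^ ε (to i))

    Π≉0 : Π ≉ 0#
    Π≉0 = ∏-≉0 _ λ i → factor (nonzero? (to i))
      where
      factor : ∀ {y} (y≉0? : Dec (y ≉ 0#)) → y ^ ind y≉0? ≉ 0#
      factor (yes y≉0) = ^-≉0 1 y≉0
      factor (no _)    = 1≉0

    π π⁻¹ : Fin q → Fin q
    π i = from (x ⊛ to i)
    π⁻¹ i = from (x⁻¹ ⊛ to i)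

    inv : ∀ {y z} → y ⊛ z ≈ 1# → ∀ i → from (y ⊛ to (from (z ⊛ to i))) ≡ i
    inv {y} {z} yz≈1 i = ≡.trans (from-cong (begin
      y ⊛ to (from (z ⊛ to i))  ≈⟨ *-congˡ (strictlyInverseˡ _) ⟩
      y ⊛ (z ⊛ to i)            ≈⟨ *-assoc _ _ _ ⟨
      y ⊛ z ⊛ to i              ≈⟨ *-congʳ yz≈1 ⟩
      1# ⊛ to i                 ≈⟨ *-identityˡ _ ⟩
      to i                      ∎)) (strictlyInverseʳ i)

    perm : Permutation.Permutation q q
    perm = Permutation.permutation π π⁻¹ (inv (trans (*-comm _ _) x⁻¹x≈1)) (inv x⁻¹x≈1)

    step : ∀ i → to (π i) ^ ε (to (π i)) ≈ x ^ ε (to i) ⊛ to i ^ ε (to i)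
    step i = begin
      -- Multiplication by the nonzero `x` preserves and reflects being zero, so reindexing leaves
      -- the exponent unchanged.
      to (π i) ^ ε (to (π i))       ≡⟨ ≡.cong (to (π i) ^_) (ind-cong
                                         (λ πi≉0 ti≈0 → πi≉0 (trans (strictlyInverseˡ _) (trans (*-congˡ ti≈0) (zeroʳ x))))
                                         (λ ti≉0 πi≈0 → *-≉0 x≉0 ti≉0 (trans (sym (strictlyInverseˡ _)) πi≈0))
                                         (nonzero? (to (π i))) (nonzero? (to i))) ⟩
      to (π i) ^ ε (to i)           ≈⟨ ^-congˡ (ε (to i)) (strictlyInverseˡ (x ⊛ to i)) ⟩
      (x ⊛ to i) ^ ε (to i)         ≈⟨ ^-distrib-* x (to i) (ε (to i)) ⟩
      x ^ ε (to i) ⊛ to i ^ ε (to i) ∎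

  ∣⇒^≈1 : ∀ {x e} → x ≉ 0# → q ∸ 1 ∣ e → x ^ e ≈ 1#
  ∣⇒^≈1 {x} x≉0 (divides-refl k) = begin
    x ^ (k * (q ∸ 1))  ≡⟨ ≡.cong (x ^_) (ℕ.*-comm k (q ∸ 1)) ⟩
    x ^ ((q ∸ 1) * k)  ≈⟨ ^-assocʳ x (q ∸ 1) k ⟨
    (x ^ (q ∸ 1)) ^ k  ≈⟨ ^-congˡ k (fermat x≉0) ⟩
    1# ^ k             ≈⟨ 1^n≈1 k ⟩
    1#                 ∎
    where open ≈-Reasoning

  -- Value at x of the monic polynomial with the given lower coefficients,
  -- constant term first.
  monic : Vec Carrier n → Carrier → Carrier
  monic []      x = 1#
  monic (a ∷ p) x = a ⊕ x ⊛ monic p x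

  -- Quotient of a monic polynomial a ∷ p by X − r; it does not depend on a.
  quotient : Carrier → Vec Carrier n → Vec Carrier n
  quotient r []      = []
  quotient r (b ∷ p) = monic (b ∷ p) r ∷ quotient r p

  -- x P(x) − r P(r) = (x − r) W(x), free of subtraction so that the semiring
  -- solver applies.
  monic-quotient : (p : Vec Carrier n) → ∀ r x → let W = monic (quotient r p) x in
                   x ⊛ monic p x ⊕ r ⊛ W ≈ r ⊛ monic p r ⊕ x ⊛ W
  monic-quotient []      r x = +-comm _ _
  monic-quotient (b ∷ p) r x = begin
    x ⊛ (b ⊕ x ⊛ P) ⊕ r ⊛ ((b ⊕ r ⊛ V) ⊕ x ⊛ W)    ≈⟨ solve 6 (λ x r b P V W →
      x :* (b :+ x :* P) :+ r :* ((b :+ r :* V) :+ x :* W) :=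
      x :* (x :* P :+ r :* W) :+ (x :* b :+ r :* (b :+ r :* V))) refl x r b P V W ⟩
    x ⊛ (x ⊛ P ⊕ r ⊛ W) ⊕ (x ⊛ b ⊕ r ⊛ (b ⊕ r ⊛ V)) ≈⟨ +-congʳ (*-congˡ (monic-quotient p r x)) ⟩
    x ⊛ (r ⊛ V ⊕ x ⊛ W) ⊕ (x ⊛ b ⊕ r ⊛ (b ⊕ r ⊛ V)) ≈⟨ solve 5 (λ x r b V W →
      x :* (r :* V :+ x :* W) :+ (x :* b :+ r :* (b :+ r :* V)) :=
      r :* (b :+ r :* V) :+ x :* ((b :+ r :* V) :+ x :* W)) refl x r b V W ⟩
    r ⊛ (b ⊕ r ⊛ V) ⊕ x ⊛ ((b ⊕ r ⊛ V) ⊕ x ⊛ W)    ∎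
    where
    open ≈-Reasoning
    P = monic p x
    V = monic p r
    W = monic (quotient r p) x

  -- Divide by X - r for the first root r. Any other root x satisfies (x - r) W(x) = 0 with x
  -- different from r, hence is a root of the quotient W, whose degree is one less.
  roots≤degree : (p : Vec Carrier n) → ∀ {xs} → Unique xs → All (λ x → monic p x ≈ 0#) xs → length xs ≤ n
  roots≤degree p       []         []               = z≤n
  roots≤degree []      (_ ∷ _)    (1≈0 ∷ _)        = contradiction 1≈0 1≉0
  roots≤degree (a ∷ p) {r ∷ _} (r∉ ∷ u) (r-root ∷ roots) =
    s≤s (roots≤degree (quotient r p) u (All.zipWith root (r∉ , roots)))
    where
    open ≈-Reasoning
    root : ∀ {x} → r ≉ x × monic (a ∷ p) x ≈ 0# → monic (quotient r p) x ≈ 0#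
    root {x} (r≉x , x-root) = decidable-stable (W ≟ 0#) λ W≉0 →
      r≉x (*-cancelˡ W≉0 (trans (*-comm W r) (trans (+-cancelˡ (r ⊛ V) _ _ (begin
        -- Both `a ⊕ r ⊛ V` and `a ⊕ x ⊛ monic p x` vanish; cancelling `a` equates the two products.
        r ⊛ V ⊕ r ⊛ W          ≈⟨ +-congʳ (+-cancelˡ a _ _ (trans r-root (sym x-root))) ⟩
        x ⊛ monic p x ⊕ r ⊛ W  ≈⟨ monic-quotient p r x ⟩
        r ⊛ V ⊕ x ⊛ W          ∎)) (*-comm x W))))
      where
      V = monic p r
      W = monic (quotient r p) x

  monic-replicate-0 : ∀ n x → monic (Vec.replicate n 0#) x ≈ x ^ n
  monic-replicate-0 zero    x = refl
  monic-replicate-0 (suc n) x = trans (+-identityˡ _) (*-congˡ (monic-replicate-0 n x))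

  -- The predicate only has to imply the equation, since it is used both for the m-th roots of c,
  -- through their common d-th power, and for the residues, which satisfy a further condition.
  count-^≈≤ : ∀ {P : U.Pred Carrier p} (P? : U.Decidable P) n .{{_ : NonZero n}} e →
              (∀ x → P x → x ^ n ≈ e) → count P? elements ≤ n
  -- The vector holds the lower coefficients of T^(n+1) - e; a positive exponent keeps the constant
  -- term apart from the leading 1.
  count-^≈≤ P? (suc n) e P⇒^≈e = roots≤degree (⊖ e ∷ Vec.replicate n 0#)
    (Uniqueₚ.filter⁺ setoid P? elements-unique)
    (All.map (λ {x} Px → begin
      ⊖ e ⊕ x ⊛ monic (Vec.replicate n 0#) x  ≈⟨ +-congˡ (*-congˡ (monic-replicate-0 n x)) ⟩
      ⊖ e ⊕ x ^ suc n                         ≈⟨ +-congˡ (P⇒^≈e x Px) ⟩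
      ⊖ e ⊕ e                                 ≈⟨ -‿inverseˡ e ⟩
      0#                                      ∎) (all-filter P? elements))
    where open ≈-Reasoning

  ∑≤-^≈ : ∀ {P : U.Pred Carrier p} (P? : U.Decidable P) n .{{_ : NonZero n}} e →
            (∀ x → P x → x ^ n ≈ e) → ∑[ i < q ] ind (P? (to i)) ≤ n
  ∑≤-^≈ P? n e P⇒^≈e = ≡.subst (_≤ n) (count-tabulate P? to) (count-^≈≤ P? n e P⇒^≈e)

  -- The number of m-th roots of an element

  #√ : ℕ → Carrier → ℕ
  #√ m c = ∑[ i < q ] ind (to i ^ m ≟ c)

  #√-cong : ∀ m {x y} → x ≈ y → #√ m x ≡ #√ m y
  #√-cong m x≈y = sum-cong-≗ λ i → ind-cong
    (λ eq → trans eq x≈y) (λ eq → trans eq (sym x≈y)) (to i ^ m ≟ _) (to i ^ m ≟ _)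

  -- The cofactor `k` of `gcd m (q ∸ 1)` in `q ∸ 1` is given by its defining product, which keeps
  -- division out of the argument.
  module Roots (m : ℕ) .{{_ : NonZero m}} (k : ℕ) (k*d≡q-1 : k * gcd m (q ∸ 1) ≡ q ∸ 1) where
    d : ℕ
    d = gcd m (q ∸ 1)

    instance
      k-nonZero : NonZero k
      k-nonZero = ℕ.m*n≢0⇒m≢0 k {{≡.subst NonZero (≡.sym k*d≡q-1) q-1-nonZero}}

      d-nonZero : NonZero d
      d-nonZero = ℕ.m*n≢0⇒n≢0 k {{≡.subst NonZero (≡.sym k*d≡q-1) q-1-nonZero}}

    -- Since d divides m, the exponent mk is a multiple of dk = q - 1.
    ^m^k≈1 : ∀ {x} → x ≉ 0# → (x ^ m) ^ k ≈ 1#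
    ^m^k≈1 {x} x≉0 = begin
      (x ^ m) ^ k  ≈⟨ ^-assocʳ x m k ⟩
      x ^ (m * k)  ≈⟨ ∣⇒^≈1 x≉0 (≡.subst₂ _∣_ k*d≡q-1 (ℕ.*-comm k m) (*-monoʳ-∣ k (gcd[m,n]∣m m (q ∸ 1)))) ⟩
      1#           ∎
      where open ≈-Reasoning

    -- Over the naturals, Bézout comes with two signs. From d + v(q - 1) = um the common value is
    -- c^u; from d + um = v(q - 1) it is the inverse of c^u.
    ^d-constant : ∀ {c} → c ≉ 0# → ∃ λ e → ∀ x → x ^ m ≈ c → x ^ d ≈ e
    ^d-constant {c} c≉0 with Bézout.identity (gcd-GCD m (q ∸ 1))
    ... | Bézout.+- u v eq = c ^ u , λ x x^m≈c →
      let x≉0 = ^≉0⇒≉0 m (λ x^m≈0 → c≉0 (trans (sym x^m≈c) x^m≈0)) in begin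
      x ^ d                       ≈⟨ *-identityʳ _ ⟨
      x ^ d ⊛ 1#                  ≈⟨ *-congˡ (∣⇒^≈1 x≉0 (divides-refl v)) ⟨
      x ^ d ⊛ x ^ (v * (q ∸ 1))   ≈⟨ ^-homo-* x d _ ⟨
      x ^ (d + v * (q ∸ 1))       ≡⟨ ≡.cong (x ^_) (≡.trans eq (ℕ.*-comm u m)) ⟩
      x ^ (m * u)                 ≈⟨ ^-assocʳ x m u ⟨
      (x ^ m) ^ u                 ≈⟨ ^-congˡ u x^m≈c ⟩
      c ^ u                       ∎
      where open ≈-Reasoning
    ... | Bézout.-+ u v eq with e , e*c^u≈1 ← inverse (^-≉0 u c≉0) = e , λ x x^m≈c →
      let x≉0 = ^≉0⇒≉0 m (λ x^m≈0 → c≉0 (trans (sym x^m≈c) x^m≈0)) in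
      *-cancelˡ (^-≉0 u c≉0) (begin
      c ^ u ⊛ x ^ d               ≈⟨ *-comm _ _ ⟩
      x ^ d ⊛ c ^ u               ≈⟨ *-congˡ (^-congˡ u x^m≈c) ⟨
      x ^ d ⊛ (x ^ m) ^ u         ≈⟨ *-congˡ (^-assocʳ x m u) ⟩
      x ^ d ⊛ x ^ (m * u)         ≈⟨ ^-homo-* x d _ ⟨
      x ^ (d + m * u)             ≡⟨ ≡.cong (x ^_) (≡.trans (≡.cong (d +_) (ℕ.*-comm m u)) eq) ⟩
      x ^ (v * (q ∸ 1))           ≈⟨ ∣⇒^≈1 x≉0 (divides-refl v) ⟩
      1#                          ≈⟨ e*c^u≈1 ⟨
      e ⊛ c ^ u                   ≈⟨ *-comm _ _ ⟩
      c ^ u ⊛ e                   ∎)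
      where open ≈-Reasoning

    #√≤d : ∀ {c} → c ≉ 0# → #√ m c ≤ d
    #√≤d {c} c≉0 with e , ^d≈e ← ^d-constant c≉0 = ∑≤-^≈ (λ x → x ^ m ≟ c) d e ^d≈e

    #√-zero : ∀ {c} → c ≈ 0# → #√ m c ≡ 1
    #√-zero {c} c≈0 = ≡.trans (sum-cong-≗ λ i → ind-cong
      (λ eq → decidable-stable (to i ≟ 0#) λ ti≉0 → ^-≉0 m ti≉0 (trans eq c≈0))
      (λ ti≈0 → trans (≈0⇒^≈0 m ti≈0) (sym c≈0))
      (to i ^ m ≟ c) (to i ≟ 0#)) count-zero

    #√-nonresidue : ∀ {c} → c ≉ 0# → c ^ k ≉ 1# → #√ m c ≡ 0
    #√-nonresidue {c} c≉0 c^k≉1 = sum-zero _ λ i → ind-no (to i ^ m ≟ c) λ x^m≈c →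
      c^k≉1 (trans (^-congˡ k (sym x^m≈c))
        (^m^k≈1 (^≉0⇒≉0 m (λ x^m≈0 → c≉0 (trans (sym x^m≈c) x^m≈0)))))

    Residue : Carrier → Set ℓ₁
    Residue c = c ≉ 0# × c ^ k ≈ 1#

    -- Built so that, for c = b(γ) and `k` the quotient in `[q-1]/d`, it is literally the second
    -- half of the test in `n₁`.
    residue? : ∀ c → Dec (Residue c)
    residue? c = nonzero? c ×-dec (c ^ k ≟ 1#)

    -- The m-th power of a nonzero element is exactly one element of the field, and it is a residue;
    -- the m-th power of 0 is 0, which is not. Hence only the index of `to i ^ m` can contribute.
    residue-^m : ∀ i → ∑[ j < q ] (ind (residue? (to j)) * ind (to i ^ m ≟ to j)) ≡ ind (nonzero? (to i))
    residue-^m i = ≡.trans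
      (sum-single _ (from y) λ j j≢ → ≡.trans
        (≡.cong (ind (residue? (to j)) *_) (ind-no (y ≟ to j) (λ eq → to≉ j≢ (sym eq))))
        (ℕ.*-zeroʳ (ind (residue? (to j)))))
      (≡.trans (≡.sym (ind-× (residue? (to (from y))) (y ≟ to (from y))))
        (ind-cong to-from from-to
          (residue? (to (from y)) ×-dec (y ≟ to (from y))) (nonzero? (to i))))
      where
      y = to i ^ m
      tfy≈y : to (from y) ≈ y
      tfy≈y = strictlyInverseˡ y
      to-from : Residue (to (from y)) × y ≈ to (from y) → to i ≉ 0#
      to-from ((y≉0 , _) , _) = ^≉0⇒≉0 m (λ y≈0 → y≉0 (trans tfy≈y y≈0))
      from-to : to i ≉ 0# → Residue (to (from y)) × y ≈ to (from y)
      from-to ti≉0 = ((λ eq → ^-≉0 m ti≉0 (trans (sym tfy≈y) eq))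
                      , trans (^-congˡ k tfy≈y) (^m^k≈1 ti≉0)) , sym tfy≈y

    ∑-#√-residues : ∑[ j < q ] (ind (residue? (to j)) * #√ m (to j)) ≡ q ∸ 1
    ∑-#√-residues = begin
      ∑[ j < q ] (ind (residue? (to j)) * #√ m (to j))
        ≡⟨ sum-cong-≗ (λ j → *-distribˡ-sum (ind (residue? (to j))) (λ i → ind (to i ^ m ≟ to j))) ⟩
      ∑[ j < q ] ∑[ i < q ] (ind (residue? (to j)) * ind (to i ^ m ≟ to j))
        ≡⟨ ∑-comm (λ j i → ind (residue? (to j)) * ind (to i ^ m ≟ to j)) ⟩
      ∑[ i < q ] ∑[ j < q ] (ind (residue? (to j)) * ind (to i ^ m ≟ to j))
        ≡⟨ sum-cong-≗ residue-^m ⟩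
      ∑[ i < q ] ind (nonzero? (to i))
        ≡⟨ count-nonzero ⟩
      q ∸ 1 ∎
      where open ≡.≡-Reasoning

    #√-residue : ∀ {c} → Residue c → #√ m c ≡ d
    #√-residue {c} (c≉0 , c^k≈1) = begin
      #√ m c                       ≡⟨ #√-cong m (strictlyInverseˡ c) ⟨
      #√ m (to j)                  ≡⟨ ℕ.*-identityˡ _ ⟨
      1 * #√ m (to j)              ≡⟨ ≡.cong (_* #√ m (to j)) j-residue ⟨
      ind (residue? (to j)) * #√ m (to j)
                                   -- The weights `ind (residue? _)` extend the bound by `d` from
                                   -- the residues to all indices, so that the two sums can be
                                   -- compared term by term; at the index of `c` the weight is 1.
                                   ≡⟨ sum-tight _ (λ i → ind (residue? (to i)) * d) bound total j ⟩
      ind (residue? (to j)) * d    ≡⟨ ≡.cong (_* d) j-residue ⟩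
      1 * d                        ≡⟨ ℕ.*-identityˡ d ⟩
      d                            ∎
      where
      open ≡.≡-Reasoning
      j = from c
      j-residue : ind (residue? (to j)) ≡ 1
      j-residue = ind-yes (residue? (to j))
        ((λ eq → c≉0 (trans (sym (strictlyInverseˡ c)) eq)) , trans (^-congˡ k (strictlyInverseˡ c)) c^k≈1)
      bound : ∀ i → ind (residue? (to i)) * #√ m (to i) ≤ ind (residue? (to i)) * d
      bound i = case (residue? (to i))
        where
        case : (res? : Dec (Residue (to i))) → ind res? * #√ m (to i) ≤ ind res? * d
        case (yes (ti≉0 , _)) = ℕ.*-monoʳ-≤ 1 (#√≤d ti≉0)
        case (no _)           = z≤n
      total : ∑[ i < q ] (ind (residue? (to i)) * d) ≤ ∑[ i < q ] (ind (residue? (to i)) * #√ m (to i))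
      total = ℕ.≤-trans
        (ℕ.≤-reflexive (≡.sym (*-distribʳ-sum d (λ i → ind (residue? (to i))))))
        -- Residues are roots of T^k - 1, so there are at most `k` of them.
        (ℕ.≤-trans (ℕ.*-monoˡ-≤ d (∑≤-^≈ residue? k 1# λ _ → proj₂))
          (ℕ.≤-reflexive (≡.trans k*d≡q-1 (≡.sym ∑-#√-residues))))

    -- The two summands become the contributions to `n₀` and `n₁`. Both decisions are abstracted in
    -- `cases`, so that `residue? c`, which contains `c ≟ 0#`, computes along with it.
    #√-formula : ∀ c → #√ m c ≡ ind (c ≟ 0#) + d * ind (residue? c)
    #√-formula c = cases (c ≟ 0#) (c ^ k ≟ 1#)
      where
      cases : (c≈0? : Dec (c ≈ 0#)) (c^k≈1? : Dec (c ^ k ≈ 1#)) →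
              #√ m c ≡ ind c≈0? + d * ind (¬? c≈0? ×-dec c^k≈1?)
      cases (yes c≈0) _           = ≡.trans (#√-zero c≈0) (≡.cong suc (≡.sym (ℕ.*-zeroʳ d)))
      cases (no c≉0)  (yes c^k≈1) = ≡.trans (#√-residue (c≉0 , c^k≈1)) (≡.sym (ℕ.*-identityʳ d))
      cases (no c≉0)  (no c^k≉1)  = ≡.trans (#√-nonresidue c≉0 c^k≉1) (≡.sym (ℕ.*-zeroʳ d))

  -- Evaluation in two and three variables, and Q at X = 0

  open Setting 𝔽 using
    ( module F[T]; module F[X,Z]; module F[X,Y,Z]; eval₁; eval₂; eval₃; atX; X; Y; inZ
    ; _≈₁_; _*₁_; _^₁_; _≈₃_; _+₃_; _*₃_; -₃_; _^₃_
    ; d; d-nonZero; [q-1]/d; N₀′; n₀; n₁; #roots; δ )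

  id-homo : IsRingHomomorphism rawRing rawRing id
  id-homo = Identity.isRingHomomorphism rawRing λ {x} → refl {x}

  module Eval₁ x = Evaluation.At commutativeRing id-homo x (eval₁ x) refl (λ _ _ → refl)
  module Eval₂ x z = Evaluation.At commutativeRing (Eval₁.⟦⟧-homo x) z (eval₂ x z) refl (λ _ _ → refl)
  module Eval₃ x y z = Evaluation.At commutativeRing (Eval₂.⟦⟧-homo x z) y (eval₃ x y z) refl (λ _ _ → refl)

  -- Needed at 0, whose enumerated copy `to (from 0#)` equals it only up to `≈`.
  eval₁-congʳ : ∀ f {x y} → x ≈ y → eval₁ x f ≈ eval₁ y f
  eval₁-congʳ []      x≈y = refl
  eval₁-congʳ (a ∷ f) x≈y = +-congˡ (*-cong x≈y (eval₁-congʳ f x≈y))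

  eval₂-constants : ∀ x z b → eval₂ x z (map F[T].const b) ≈ eval₁ z b
  eval₂-constants x z []      = refl
  eval₂-constants x z (a ∷ b) = +-cong (Eval₁.⟦const⟧ x a) (*-congˡ (eval₂-constants x z b))

  module _ (m : ℕ) (Q Q₁ : F[X,Y,Z].Poly) (b : F[T].Poly)
           (Q≈ : Q ≈₃ X *₃ Q₁ +₃ Y ^₃ m +₃ -₃ inZ b) where

    Q-modulo-X : ∀ β γ → eval₃ 0# β γ Q ≈ β ^ m ⊖ eval₁ γ b
    Q-modulo-X β γ = begin
      ⟦ Q ⟧                                      ≈⟨ ⟦⟧-cong {Q} {X *₃ Q₁ +₃ Y ^₃ m +₃ -₃ inZ b} Q≈ ⟩
      ⟦ X *₃ Q₁ +₃ Y ^₃ m +₃ -₃ inZ b ⟧          ≈⟨ +-homo (X *₃ Q₁ +₃ Y ^₃ m) _ ⟩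
      ⟦ X *₃ Q₁ +₃ Y ^₃ m ⟧ ⊕ ⟦ -₃ inZ b ⟧       ≈⟨ +-cong (+-homo (X *₃ Q₁) _) (-‿homo (inZ b)) ⟩
      ⟦ X *₃ Q₁ ⟧ ⊕ ⟦ Y ^₃ m ⟧ ⊖ ⟦ inZ b ⟧       ≈⟨ +-cong (+-cong XQ₁≈0 Yᵐ≈βᵐ) (-‿cong b≈b) ⟩
      0# ⊕ β ^ m ⊖ eval₁ γ b                     ≈⟨ +-congʳ (+-identityˡ _) ⟩
      β ^ m ⊖ eval₁ γ b                          ∎
      where
      open ≈-Reasoning
      open IsRingHomomorphism (Eval₃.⟦⟧-homo 0# β γ)
      ⟦_⟧ = eval₃ 0# β γ

      XQ₁≈0 : ⟦ X *₃ Q₁ ⟧ ≈ 0#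
      XQ₁≈0 = begin
        ⟦ X *₃ Q₁ ⟧                              ≈⟨ *-homo X Q₁ ⟩
        ⟦ X ⟧ ⊛ ⟦ Q₁ ⟧                           ≈⟨ *-congʳ (Eval₃.⟦const⟧ 0# β γ (F[X,Z].const F[T].indeterminate)) ⟩
        eval₂ 0# γ (F[X,Z].const F[T].indeterminate) ⊛ ⟦ Q₁ ⟧
                                                 ≈⟨ *-congʳ (Eval₂.⟦const⟧ 0# γ F[T].indeterminate) ⟩
        eval₁ 0# F[T].indeterminate ⊛ ⟦ Q₁ ⟧     ≈⟨ *-congʳ (Eval₁.⟦indeterminate⟧ 0#) ⟩
        0# ⊛ ⟦ Q₁ ⟧                              ≈⟨ zeroˡ _ ⟩
        0#                                       ∎

      Yᵐ≈βᵐ : ⟦ Y ^₃ m ⟧ ≈ β ^ m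
      Yᵐ≈βᵐ = trans (Evaluation.^-homo commutativeRing (Eval₃.⟦⟧-homo 0# β γ) Y m)
                    (^-congˡ m (Eval₃.⟦indeterminate⟧ 0# β γ))

      b≈b : ⟦ inZ b ⟧ ≈ eval₁ γ b
      b≈b = trans (Eval₃.⟦const⟧ 0# β γ (map F[T].const b)) (eval₂-constants 0# γ b)

    Q-root⇒√ : ∀ {β γ} → eval₃ 0# β γ Q ≈ 0# → β ^ m ≈ eval₁ γ b
    Q-root⇒√ {β} {γ} Q≈0 = x∙y⁻¹≈ε⇒x≈y _ _ (trans (sym (Q-modulo-X β γ)) Q≈0)

    √⇒Q-root : ∀ {β γ} → β ^ m ≈ eval₁ γ b → eval₃ 0# β γ Q ≈ 0#
    √⇒Q-root {β} {γ} eq = trans (Q-modulo-X β γ) (trans (+-congʳ eq) (-‿inverseʳ _))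

  -- The point count, in general and for b = aZ^m

  module Count (P : F[X,Z].Poly) (m : ℕ) .{{_ : NonTrivial m}} where
    private instance
      m-nonZero : NonZero m
      m-nonZero = ℕ.nonTrivial⇒nonZero m

    k : ℕ
    k = [q-1]/d m

    open Roots m k (m/n*n≡m {{d-nonZero m}} (gcd[m,n]∣n m (q ∸ 1))) hiding (d)

    P₀? : ∀ γ → Dec (eval₂ 0# γ P ≈ 0#)
    P₀? γ = eval₂ 0# γ P ≟ 0#

    module _ (Q Q₁ : F[X,Y,Z].Poly) (b : F[T].Poly)
             (Q≈ : Q ≈₃ X *₃ Q₁ +₃ Y ^₃ m +₃ -₃ inZ b) where

      N₀′-formula : N₀′ P Q ≡ n₀ P b + d m * n₁ P b m
      N₀′-formula = begin
        N₀′ P Q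
          ≡⟨ count-cartesianProduct _ to elements ⟩
        ∑[ i < q ] count (λ γ → P₀? γ ×-dec (eval₃ 0# (to i) γ Q ≟ 0#)) elements
          ≡⟨ sum-cong-≗ (λ i → count-tabulate (λ γ → P₀? γ ×-dec (eval₃ 0# (to i) γ Q ≟ 0#)) to) ⟩
        ∑[ i < q ] ∑[ j < q ] ind (P₀? (to j) ×-dec (eval₃ 0# (to i) (to j) Q ≟ 0#))
          ≡⟨ sum-cong-≗ (λ i → sum-cong-≗ λ j → ≡.trans
               (ind-× (P₀? (to j)) (eval₃ 0# (to i) (to j) Q ≟ 0#))
               (≡.cong (ind (P₀? (to j)) *_) (ind-cong (Q-root⇒√ m Q Q₁ b Q≈) (√⇒Q-root m Q Q₁ b Q≈)
                 (eval₃ 0# (to i) (to j) Q ≟ 0#) (to i ^ m ≟ b∘to j)))) ⟩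
        ∑[ i < q ] ∑[ j < q ] (ind (P₀? (to j)) * ind (to i ^ m ≟ b∘to j))
          -- The product of lists has β outside and γ inside; with γ fixed instead, the inner sum
          -- counts the m-th roots of b(γ).
          ≡⟨ ∑-comm (λ i j → ind (P₀? (to j)) * ind (to i ^ m ≟ b∘to j)) ⟩
        ∑[ j < q ] ∑[ i < q ] (ind (P₀? (to j)) * ind (to i ^ m ≟ b∘to j))
          ≡⟨ sum-cong-≗ (λ j → *-distribˡ-sum (ind (P₀? (to j))) (λ i → ind (to i ^ m ≟ b∘to j))) ⟨
        ∑[ j < q ] (ind (P₀? (to j)) * #√ m (b∘to j))
          ≡⟨ sum-cong-≗ term ⟩
        ∑[ j < q ] (ind (P₀? (to j) ×-dec (b∘to j ≟ 0#)) + d m * ind (P₀? (to j) ×-dec residue? (b∘to j)))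
          ≡⟨ ∑-distrib-+ (λ j → ind (P₀? (to j) ×-dec (b∘to j ≟ 0#))) _ ⟩
        ∑[ j < q ] ind (P₀? (to j) ×-dec (b∘to j ≟ 0#)) + ∑[ j < q ] (d m * ind (P₀? (to j) ×-dec residue? (b∘to j)))
          ≡⟨ ≡.cong₂ _+_ (count-tabulate (λ γ → P₀? γ ×-dec (eval₁ γ b ≟ 0#)) to)
               (≡.trans (≡.cong (d m *_) (count-tabulate (λ γ → P₀? γ ×-dec residue? (eval₁ γ b)) to))
                 (*-distribˡ-sum (d m) (λ j → ind (P₀? (to j) ×-dec residue? (b∘to j))))) ⟨
        n₀ P b + d m * n₁ P b m ∎
        where
        open ≡.≡-Reasoning
        b∘to : Fin q → Carrier
        b∘to j = eval₁ (to j) b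

        term : ∀ j → ind (P₀? (to j)) * #√ m (b∘to j) ≡
                     ind (P₀? (to j) ×-dec (b∘to j ≟ 0#)) + d m * ind (P₀? (to j) ×-dec residue? (b∘to j))
        term j = begin
          π * #√ m (b∘to j)                                ≡⟨ ≡.cong (π *_) (#√-formula (b∘to j)) ⟩
          π * (ind (b∘to j ≟ 0#) + d m * ρ)                ≡⟨ ℕ.*-distribˡ-+ π _ _ ⟩
          π * ind (b∘to j ≟ 0#) + π * (d m * ρ)            ≡⟨ ≡.cong (π * ind (b∘to j ≟ 0#) +_) (ℕ*.x∙yz≈y∙xz π (d m) ρ) ⟩
          π * ind (b∘to j ≟ 0#) + d m * (π * ρ)            ≡⟨ ≡.cong₂ (λ s t → s + d m * t)
                                                             (ind-× (P₀? (to j)) (b∘to j ≟ 0#))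
                                                             (ind-× (P₀? (to j)) (residue? (b∘to j))) ⟨
          ind (P₀? (to j) ×-dec (b∘to j ≟ 0#)) + d m * ind (P₀? (to j) ×-dec residue? (b∘to j)) ∎
          where
          π = ind (P₀? (to j))
          ρ = ind (residue? (b∘to j))

    -- Covers two cases of the monomial count: for a = 0 no value of b is nonzero, and for a failing
    -- the power test every nonzero value of b fails it too.
    n₁≡0 : ∀ b → (∀ γ → eval₁ γ b ≉ 0# → eval₁ γ b ^ k ≉ 1#) → n₁ P b m ≡ 0
    n₁≡0 b nonresidue = ≡.trans
      (count-tabulate (λ γ → P₀? γ ×-dec residue? (eval₁ γ b)) to)
      (sum-zero _ λ i → ind-no (P₀? (to i) ×-dec residue? (eval₁ (to i) b))
        λ (_ , b≉0 , b^k≈1) → nonresidue (to i) b≉0 b^k≈1)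

    module Monomial (a : Carrier) (b : F[T].Poly)
                    (b≈ : b ≈₁ F[T].const a *₁ F[T].indeterminate ^₁ m) where

      eval-b : ∀ γ → eval₁ γ b ≈ a ⊛ γ ^ m
      eval-b γ = begin
        eval₁ γ b                                                  ≈⟨ ⟦⟧-cong {b} {aTᵐ} b≈ ⟩
        eval₁ γ aTᵐ                                                ≈⟨ *-homo (F[T].const a) (F[T].indeterminate ^₁ m) ⟩
        eval₁ γ (F[T].const a) ⊛ eval₁ γ (F[T].indeterminate ^₁ m) ≈⟨ *-cong (Eval₁.⟦const⟧ γ a)
          (trans (Evaluation.^-homo commutativeRing (Eval₁.⟦⟧-homo γ) F[T].indeterminate m)
                 (^-congˡ m (Eval₁.⟦indeterminate⟧ γ))) ⟩
        a ⊛ γ ^ m                                                  ∎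
        where
        open ≈-Reasoning
        open IsRingHomomorphism (Eval₁.⟦⟧-homo γ)
        aTᵐ = F[T].const a *₁ F[T].indeterminate ^₁ m

      γ≈0⇒b≈0 : ∀ {γ} → γ ≈ 0# → eval₁ γ b ≈ 0#
      γ≈0⇒b≈0 {γ} γ≈0 = trans (eval-b γ) (trans (*-congˡ (≈0⇒^≈0 m γ≈0)) (zeroʳ a))

      module _ (a≈0 : a ≈ 0#) where
        b≈0 : ∀ γ → eval₁ γ b ≈ 0#
        b≈0 γ = trans (eval-b γ) (trans (*-congʳ a≈0) (zeroˡ _))

        n₀≡#roots : n₀ P b ≡ #roots (atX 0# P)
        n₀≡#roots = begin
          n₀ P b
            ≡⟨ count-tabulate (λ γ → P₀? γ ×-dec (eval₁ γ b ≟ 0#)) to ⟩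
          ∑[ i < q ] ind (P₀? (to i) ×-dec (eval₁ (to i) b ≟ 0#))
            ≡⟨ sum-cong-≗ (λ i → ind-cong proj₁ (λ p → p , b≈0 (to i))
                 (P₀? (to i) ×-dec (eval₁ (to i) b ≟ 0#)) (P₀? (to i))) ⟩
          ∑[ i < q ] ind (P₀? (to i))
            ≡⟨ count-tabulate P₀? to ⟨
          #roots (atX 0# P) ∎
          where open ≡.≡-Reasoning

      module _ (a≉0 : a ≉ 0#) where
        γ≉0⇒b≉0 : ∀ {γ} → γ ≉ 0# → eval₁ γ b ≉ 0#
        γ≉0⇒b≉0 {γ} γ≉0 b≈0 = *-≉0 a≉0 (^-≉0 m γ≉0) (trans (sym (eval-b γ)) b≈0)

        -- A nonzero value of b forces γ to be nonzero, and then the factor (γ^m)^k is 1: the power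
        -- test on b(γ) depends on a alone.
        b^k≈a^k : ∀ {γ} → eval₁ γ b ≉ 0# → eval₁ γ b ^ k ≈ a ^ k
        b^k≈a^k {γ} b≉0 = begin
          eval₁ γ b ^ k        ≈⟨ ^-congˡ k (eval-b γ) ⟩
          (a ⊛ γ ^ m) ^ k      ≈⟨ ^-distrib-* a (γ ^ m) k ⟩
          a ^ k ⊛ (γ ^ m) ^ k  ≈⟨ *-congˡ (^m^k≈1 (b≉0 ∘ γ≈0⇒b≈0)) ⟩
          a ^ k ⊛ 1#           ≈⟨ *-identityʳ _ ⟩
          a ^ k                ∎
          where open ≈-Reasoning

        n₀≡δ : n₀ P b ≡ δ P
        n₀≡δ = begin
          n₀ P b
            ≡⟨ count-tabulate (λ γ → P₀? γ ×-dec (eval₁ γ b ≟ 0#)) to ⟩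
          ∑[ i < q ] ind (P₀? (to i) ×-dec (eval₁ (to i) b ≟ 0#))
            -- For a nonzero, aγ^m vanishes only at γ = 0, so one index survives.
            ≡⟨ sum-single _ z (λ i i≢z → ind-no (P₀? (to i) ×-dec (eval₁ (to i) b ≟ 0#))
                 (γ≉0⇒b≉0 (to≉ i≢z) ∘ proj₂)) ⟩
          ind (P₀? (to z) ×-dec (eval₁ (to z) b ≟ 0#))
            -- `δ P` unfolds to `ind (P₀? 0#)`.
            ≡⟨ ind-cong (λ (p , _) → trans (sym Pz≈P0) p) (λ p → trans Pz≈P0 p , γ≈0⇒b≈0 z≈0)
                 (P₀? (to z) ×-dec (eval₁ (to z) b ≟ 0#)) (P₀? 0#) ⟩
          δ P ∎
          where
          open ≡.≡-Reasoning
          z = from 0#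
          z≈0 : to z ≈ 0#
          z≈0 = strictlyInverseˡ 0#
          Pz≈P0 : eval₂ 0# (to z) P ≈ eval₂ 0# 0# P
          Pz≈P0 = eval₁-congʳ (atX 0# P) z≈0

        -- Stated additively so that r - δ never appears as a truncated subtraction.
        n₁+n₀≡#roots : a ^ k ≈ 1# → n₁ P b m + n₀ P b ≡ #roots (atX 0# P)
        n₁+n₀≡#roots a^k≈1 = begin
          n₁ P b m + n₀ P b
            ≡⟨ ≡.cong₂ _+_ (count-tabulate (λ γ → P₀? γ ×-dec residue? (eval₁ γ b)) to)
                           (count-tabulate (λ γ → P₀? γ ×-dec (eval₁ γ b ≟ 0#)) to) ⟩
          ∑[ i < q ] ind (P₀? (to i) ×-dec residue? (b∘to i)) + ∑[ i < q ] ind (P₀? (to i) ×-dec (b∘to i ≟ 0#))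
            ≡⟨ ∑-distrib-+ (λ i → ind (P₀? (to i) ×-dec residue? (b∘to i))) _ ⟨
          ∑[ i < q ] (ind (P₀? (to i) ×-dec residue? (b∘to i)) + ind (P₀? (to i) ×-dec (b∘to i ≟ 0#)))
            ≡⟨ sum-cong-≗ (λ i → ind-split (P₀? (to i)) (b∘to i ≟ 0#) (b∘to i ^ k ≟ 1#)
                 λ b≉0 → trans (b^k≈a^k b≉0) a^k≈1) ⟩
          ∑[ i < q ] ind (P₀? (to i))
            ≡⟨ count-tabulate P₀? to ⟨
          #roots (atX 0# P) ∎
          where
          open ≡.≡-Reasoning
          b∘to : Fin q → Carrier
          b∘to i = eval₁ (to i) b

-- Opened only now, since +_ is ambiguous with the sections (n +_) above.
open import Data.Integer.Base as ℤ using (+_; 1ℤ)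

-- The passage from n₀ + d n₁ to the form in r = n₁ + n₀. It takes place in the integers because 1 -
-- d may be negative.
δ+dn≡d[n+δ]+[1-d]δ : ∀ d n δ → + (δ + d * n) ≡ + d ℤ.* + (n + δ) ℤ.+ (1ℤ ℤ.- + d) ℤ.* + δ
δ+dn≡d[n+δ]+[1-d]δ d n δ = begin
  + (δ + d * n)                                     ≡⟨ ≡.cong (λ t → + δ ℤ.+ t) (ℤ.pos-* d n) ⟩
  + δ ℤ.+ + d ℤ.* + n                               ≡⟨ solve 3 (λ d n δ →
    δ :+ d :* n := d :* (n :+ δ) :+ (con 1ℤ :- d) :* δ) ≡.refl (+ d) (+ n) (+ δ) ⟩
  + d ℤ.* + (n + δ) ℤ.+ (1ℤ ℤ.- + d) ℤ.* + δ        ∎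
  where
  open ≡.≡-Reasoning
  open ℤSolver.+-*-Solver

theorem4p22 : ∀ {c ℓ₁ ℓ₂} (𝔽 : FiniteField c ℓ₁ ℓ₂) → let open Setting 𝔽 in
    (P : F[X,Z].Poly) →
    F[X,Z].Monic P →
    (∃ λ k → F[X,Z].HasDegree P k × 2 ≤ k) →
    (m : ℕ) .{{_ : NonTrivial m}} →
    (Q Q₁ : F[X,Y,Z].Poly) (b : F[T].Poly) →
    F[X,Y,Z].DegreeBelow Q₁ m →
    Q ≈₃ X *₃ Q₁ +₃ Y ^₃ m +₃ -₃ inZ b →
    (N₀′ P Q ≡ n₀ P b + d m * n₁ P b m)
    ×
    ((a : Carrier) (r : ℕ) →
    b ≈₁ F[T].const a *₁ F[T].indeterminate ^₁ m →
    #roots (atX 0# P) ≡ r →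
    (a ≈ 0# → N₀′ P Q ≡ r)
    × (a ≉ 0# → a ^ [q-1]/d m ≉ 1# → N₀′ P Q ≡ δ P)
    × (a ≉ 0# → a ^ [q-1]/d m ≈ 1# →
    + (N₀′ P Q) ≡ + (d m) ℤ.* + r ℤ.+ (1ℤ ℤ.- + (d m)) ℤ.* + (δ P)))
theorem4p22 𝔽 P _ _ m Q Q₁ b _ Q≈ = part-i , λ where
    -- Matching on the equation replaces `r` by the number of roots of P(0,Z).
    a r b≈ ≡.refl → let open Monomial a b b≈ in
      (λ a≈0 → ≡.trans
        (n₁≡0⇒N₀′≡n₀ (n₁≡0 b λ γ b≉0 _ → b≉0 (b≈0 a≈0 γ)))
        (n₀≡#roots a≈0)) ,
      (λ a≉0 a^k≉1 → ≡.trans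
        (n₁≡0⇒N₀′≡n₀ (n₁≡0 b λ γ b≉0 b^k≈1 → a^k≉1 (trans (sym (b^k≈a^k a≉0 b≉0)) b^k≈1)))
        (n₀≡δ a≉0)) ,
      (λ a≉0 a^k≈1 → begin
        + N₀′ P Q
          ≡⟨ ≡.cong +_ part-i ⟩
        + (n₀ P b + d m * n₁ P b m)
          ≡⟨ δ+dn≡d[n+δ]+[1-d]δ (d m) (n₁ P b m) (n₀ P b) ⟩
        + d m ℤ.* + (n₁ P b m + n₀ P b) ℤ.+ (1ℤ ℤ.- + d m) ℤ.* + n₀ P b
          ≡⟨ ≡.cong₂ (λ r δ → + d m ℤ.* + r ℤ.+ (1ℤ ℤ.- + d m) ℤ.* + δ)
               (n₁+n₀≡#roots a≉0 a^k≈1) (n₀≡δ a≉0) ⟩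
        + d m ℤ.* + #roots (atX 0# P) ℤ.+ (1ℤ ℤ.- + d m) ℤ.* + δ P ∎)
  where
  open Setting 𝔽
  open FiniteField 𝔽 using (trans; sym)
  open Field 𝔽 using (module Count)
  open Count P m
  open ≡.≡-Reasoning

  part-i : N₀′ P Q ≡ n₀ P b + d m * n₁ P b m
  part-i = N₀′-formula Q Q₁ b Q≈

  n₁≡0⇒N₀′≡n₀ : n₁ P b m ≡ 0 → N₀′ P Q ≡ n₀ P b
  n₁≡0⇒N₀′≡n₀ n₁≡0 = begin
    N₀′ P Q                     ≡⟨ part-i ⟩
    n₀ P b + d m * n₁ P b m     ≡⟨ ≡.cong (λ t → n₀ P b + d m * t) n₁≡0 ⟩
    n₀ P b + d m * 0            ≡⟨ ≡.cong (λ t → n₀ P b + t) (ℕ.*-zeroʳ (d m)) ⟩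
    n₀ P b + 0                  ≡⟨ ℕ.+-identityʳ (n₀ P b) ⟩
    n₀ P b                      ∎
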